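{- For every prime $p>3$, $$\sum_{k=1}^{p-1}\frac{(1/2)_k^2}{(1)_k^2}\cdot\frac{1}{k}\equiv -2H_{(p-1)/2}(1)\pmod{p^3},$$ and $$\sum_{k=1}^{p-1}\frac{(1/2)_k^2}{(1)_k^2}\cdot\frac{1}{k^2}\equiv -2H_{(p-1)/2}(1)^2\pmod{p^2}.$$
   Context: $(y)_n=y(y+1)\cdots(y+n-1)$ is the Pochhammer symbol. $H_n(1)=\sum_{k=1}^n\frac{1}{k}$ is the $n$-th harmonic number. For rationals $u,v$, $u\equiv v\pmod{p^s}$ means $u-v$ has $p$-adic valuation at least $s$. -}

module Defs where

open import Data.Nat as ℕ using (ℕ; zero; suc)
open import Data.Integer as ℤ using (ℤ; +_)
open import Data.Integer.Divisibility using () renaming (_∣_ to _∣ℤ_)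
open import Data.Nat.Divisibility using (_∣_)
open import Data.Rational as ℚ using (ℚ; 0ℚ; 1ℚ; _+_; _*_; _-_; ↥_; ↧ₙ_)
open import Data.Empty using (⊥)
open import Data.Product using (_×_)
open import Data.Sum using (_⊎_)
open import Relation.Binary.PropositionalEquality using (_≡_)
open import Relation.Nullary using (¬_; yes; no)

ℚ[_] : ℕ → ℚ
ℚ[ n ] = (+ n) ℚ./ 1

poch : ℚ → ℕ → ℚ
poch y zero    = 1ℚ
poch y (suc n) = poch y n * (y + ℚ[ n ])

-- total division on ℚ (x ÷ 0 := 0); only ever used with nonzero divisors
_÷_ : ℚ → ℚ → ℚ
x ÷ y with y ℚ.≟ 0ℚ
... | yes _ = 0ℚ
... | no y≢0 = ℚ._÷_ x y {{ℚ.≢-nonZero y≢0}}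

sumFrom1 : ℕ → (ℕ → ℚ) → ℚ
sumFrom1 zero    f = 0ℚ
sumFrom1 (suc n) f = sumFrom1 n f + f (suc n)

H : ℕ → ℚ
H n = sumFrom1 n (λ k → 1ℚ ÷ ℚ[ k ])

half : ℚ
half = (+ 1) ℚ./ 2

-- u ≡ v (mod p^s) : the p-adic valuation of u - v is at least s.
-- For a reduced fraction a/b (b > 0, gcd(a,b)=1) this means:
-- a = 0, or (p^s ∣ a and p ∤ b).
_≡_[mod_^_] : ℚ → ℚ → ℕ → ℕ → Set
u ≡ v [mod p ^ s ] =
  let d = u - v in
  (↥ d ≡ + 0) ⊎ ((p ℕ.^ s) ∣ ℤ.∣ ↥ d ∣ × ¬ (p ∣ ↧ₙ d))

{-# OPTIONS --safe #-}

-- Put p = 2m + 1, T w k = ∏_{j<k} (j (j + 1) - w) / k!² and Sᵢ w = ∑_{k<p} T w k / kⁱ. The left-hand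
-- sides are S₁ and S₂ at w = -1/4, whereas w = x (x + 1) gives T w k = (-x)ₖ (x + 1)ₖ / k!². Telescoping
-- in x, with ∏_{j<p} (1 - x²/j²) vanishing at x = 1, …, p - 1, evaluates S₁ and S₂ exactly at
-- w = m (m + 1) as -2 H m and -2 (H m)². As m (m + 1) = -1/4 + u with u = p²/4, the second congruence follows.
--
-- For the first, T is polynomial in w with p-integral coefficients, so 9 S₁(-1/4 + u) - S₁(-1/4 + 9u) - 8 S₁(-1/4)
-- is divisible by u². Here -1/4 + 9u = x (x + 1) for x = p + m, hence it suffices that S₁ takes the same value
-- mod p³ at x = m and x = p + m. This is the case s = m of a congruence between x = p + s and x = p - 1 - s,
-- by induction on s; the only non-trivial product is ∏_{j<p} (1 - (p + s)²/j²) ≡ 2p²/s² (mod p³).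
module Submission where

open import Defs
open import Data.Nat using (ℕ; _>_; _∸_; _/_)
open import Data.Nat.Primality using (Prime)
open import Data.Rational using (_*_; -_)
open import Data.Product using (_×_)

open import Data.Nat as ℕ using (zero; suc; s≤s)
open import Data.Nat.Coprimality as Coprimality using (Coprime; coprime-divisor)
open import Data.Nat.Divisibility
open import Data.Nat.DivMod using (_%_; m≡m%n+[m/n]*n; m%n<n)
open import Data.Nat.Primality
  using (euclidsLemma; prime⇒irreducible; prime⇒nonZero; prime⇒nonTrivial)
import Data.Nat.Properties as ℕₚ
open import Data.Integer as ℤ using (ℤ; +_; 1ℤ)
import Data.Integer.Properties as ℤₚ
open import Data.Rational as ℚ using (ℚ; 0ℚ; 1ℚ; _+_; _-_; ↥_; ↧_; ↧ₙ_; toℚᵘ)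
import Data.Rational.Properties as ℚₚ
open import Data.Rational.Unnormalised as ℚᵘ using (mkℚᵘ)
import Data.Rational.Unnormalised.Properties as ℚᵘₚ
open import Data.Product using (_,_; proj₁; proj₂; ∃-syntax)
open import Data.Sum using (inj₁; inj₂)
open import Level using (0ℓ)
open import Relation.Binary.PropositionalEquality
open import Relation.Nullary using (¬_; yes; no; contradiction)
open import Relation.Nullary.Decidable using (dec⇒maybe)
open import Tactic.RingSolver using (solve-∀)
open import Tactic.RingSolver.Core.AlmostCommutativeRing
  using (AlmostCommutativeRing; fromCommutativeRing)

-- Ring identities in ℚ modulo hypotheses.

ℚ-ring : AlmostCommutativeRing 0ℓ 0ℓ
ℚ-ring = fromCommutativeRing ℚₚ.+-*-commutativeRing (λ x → dec⇒maybe (0ℚ ℚ.≟ x))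

-- The ring solver takes no hypotheses: an equality following from hypotheses lᵢ ≡ rᵢ is proved by a
-- solver identity x ≡ y + ∑ᵢ (lᵢ - rᵢ) * zᵢ, whose error terms are then discharged by vanish and ⊞.
≡-modulo : ∀ {x y d} → x ≡ y + d → d ≡ 0ℚ → x ≡ y
≡-modulo {y = y} x≡y+d refl = trans x≡y+d (ℚₚ.+-identityʳ y)

infixl 6 _⊞_
_⊞_ : ∀ {x y} → x ≡ 0ℚ → y ≡ 0ℚ → x + y ≡ 0ℚ
refl ⊞ refl = refl

*-vanishˡ : ∀ {x} y → x ≡ 0ℚ → x * y ≡ 0ℚ
*-vanishˡ y refl = ℚₚ.*-zeroˡ y

vanish : ∀ {x y} → x ≡ y → ∀ {z} → (x - y) * z ≡ 0ℚ
vanish {x} refl {z} = *-vanishˡ z (ℚₚ.+-inverseʳ x)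

-- Integers inside ℚ, division and reciprocals.

fromℤ : ℤ → ℚ
fromℤ i = i ℚ./ 1

toℚᵘ-fromℤ : ∀ i → toℚᵘ (fromℤ i) ℚᵘ.≃ mkℚᵘ i 0
toℚᵘ-fromℤ i = ℚₚ.toℚᵘ-fromℚᵘ (mkℚᵘ i 0)

fromℤ-+ : ∀ i j → fromℤ (i ℤ.+ j) ≡ fromℤ i + fromℤ j
fromℤ-+ i j = ℚₚ.toℚᵘ-injective (begin
  toℚᵘ (fromℤ (i ℤ.+ j))                 ≈⟨ toℚᵘ-fromℤ (i ℤ.+ j) ⟩
  mkℚᵘ (i ℤ.+ j) 0                       ≡⟨ cong₂ (λ a b → mkℚᵘ (a ℤ.+ b) 0) (ℤₚ.*-identityʳ i) (ℤₚ.*-identityʳ j) ⟨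
  mkℚᵘ i 0 ℚᵘ.+ mkℚᵘ j 0                 ≈⟨ ℚᵘₚ.+-cong (toℚᵘ-fromℤ i) (toℚᵘ-fromℤ j) ⟨
  toℚᵘ (fromℤ i) ℚᵘ.+ toℚᵘ (fromℤ j)     ≈⟨ ℚₚ.toℚᵘ-homo-+ (fromℤ i) (fromℤ j) ⟨
  toℚᵘ (fromℤ i + fromℤ j)               ∎)
  where open ℚᵘₚ.≃-Reasoning

fromℤ-* : ∀ i j → fromℤ (i ℤ.* j) ≡ fromℤ i * fromℤ j
fromℤ-* i j = ℚₚ.toℚᵘ-injective (begin
  toℚᵘ (fromℤ (i ℤ.* j))                 ≈⟨ toℚᵘ-fromℤ (i ℤ.* j) ⟩
  mkℚᵘ i 0 ℚᵘ.* mkℚᵘ j 0                 ≈⟨ ℚᵘₚ.*-cong (toℚᵘ-fromℤ i) (toℚᵘ-fromℤ j) ⟨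
  toℚᵘ (fromℤ i) ℚᵘ.* toℚᵘ (fromℤ j)     ≈⟨ ℚₚ.toℚᵘ-homo-* (fromℤ i) (fromℤ j) ⟨
  toℚᵘ (fromℤ i * fromℤ j)               ∎)
  where open ℚᵘₚ.≃-Reasoning

fromℤ-injective : ∀ {i j} → fromℤ i ≡ fromℤ j → i ≡ j
fromℤ-injective {i} {j} eq with ℚₚ./-injective-≃ (mkℚᵘ i 0) (mkℚᵘ j 0) eq
... | ℚᵘ.*≡* i1≡j1 = ℤₚ.*-cancelʳ-≡ i j 1ℤ i1≡j1

p*↧p≡↥p : ∀ p → p * ℚ[ ↧ₙ p ] ≡ fromℤ (↥ p)
p*↧p≡↥p p@record{} = ℚₚ.toℚᵘ-injective (begin
  toℚᵘ (p * ℚ[ ↧ₙ p ])           ≈⟨ ℚₚ.toℚᵘ-homo-* p ℚ[ ↧ₙ p ] ⟩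
  toℚᵘ p ℚᵘ.* toℚᵘ ℚ[ ↧ₙ p ]     ≈⟨ ℚᵘₚ.*-congˡ {toℚᵘ p} (toℚᵘ-fromℤ (↧ p)) ⟩
  toℚᵘ p ℚᵘ.* mkℚᵘ (↧ p) 0       ≈⟨ ℚᵘ.*≡* (trans (ℤₚ.*-identityʳ _) (cong (λ n → ↥ p ℤ.* + n) (sym (ℕₚ.*-identityʳ (↧ₙ p))))) ⟩
  mkℚᵘ (↥ p) 0                   ≈⟨ toℚᵘ-fromℤ (↥ p) ⟨
  toℚᵘ (fromℤ (↥ p))             ∎)
  where open ℚᵘₚ.≃-Reasoning

ℚ[]-+ : ∀ m n → ℚ[ m ℕ.+ n ] ≡ ℚ[ m ] + ℚ[ n ]
ℚ[]-+ m n = fromℤ-+ (+ m) (+ n)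

ℚ[]-* : ∀ m n → ℚ[ m ℕ.* n ] ≡ ℚ[ m ] * ℚ[ n ]
ℚ[]-* m n = trans (cong fromℤ (ℤₚ.pos-* m n)) (fromℤ-* (+ m) (+ n))

ℚ[]-suc : ∀ n → ℚ[ suc n ] ≡ ℚ[ n ] + 1ℚ
ℚ[]-suc n = trans (ℚ[]-+ 1 n) (ℚₚ.+-comm 1ℚ ℚ[ n ])

-- Exhibiting an inverse of the divisor rules out the default branch of `÷`, so later uses need no
-- proof that the divisor is nonzero.
÷≡* : ∀ x {y z} → y * z ≡ 1ℚ → x ÷ y ≡ x * z
÷≡* x {y} {z} yz≡1 with y ℚ.≟ 0ℚ
... | yes refl = contradiction (trans (sym yz≡1) (ℚₚ.*-zeroˡ z)) λ ()
... | no  y≢0  = ≡-modulo (ring x y (ℚ.1/ y) z)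
                   (vanish (ℚₚ.*-inverseˡ y) ⊞ vanish yz≡1)
  where
  instance _ = ℚ.≢-nonZero y≢0
  ring : ∀ x y i z → x * i ≡ x * z + ((i * y - 1ℚ) * (x * z) + (y * z - 1ℚ) * (- (x * i)))
  ring = solve-∀ ℚ-ring

squares-inverse : ∀ x y → x * y ≡ 1ℚ → x * x * (y * y) ≡ 1ℚ
squares-inverse x y xy≡1 = ≡-modulo (ring x y) (vanish xy≡1)
  where
  ring : ∀ f q → f * f * (q * q) ≡ 1ℚ + (f * q - 1ℚ) * (f * q + 1ℚ)
  ring = solve-∀ ℚ-ring

-- The summand of `H` verbatim, so that `H (suc n)` unfolds to `H n + recip (suc n)`.
recip : ℕ → ℚ
recip k = 1ℚ ÷ ℚ[ k ]

ℚ[suc]≢0 : ∀ n → ℚ[ suc n ] ≢ 0ℚ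
ℚ[suc]≢0 n eq with () ← fromℤ-injective {+ suc n} {+ 0} eq

*-recip : ∀ k → ℚ[ suc k ] * recip (suc k) ≡ 1ℚ
*-recip k with ℚ[ suc k ] ℚ.≟ 0ℚ
... | yes eq  = contradiction eq (ℚ[suc]≢0 k)
... | no  neq = trans (cong (ℚ[ suc k ] *_) (ℚₚ.*-identityˡ _)) (ℚₚ.*-inverseʳ ℚ[ suc k ])
  where instance _ = ℚ.≢-nonZero neq

-- Hypergeometric terms and telescoping in x.

sumFrom1-cong : ∀ {f g} → (∀ k → f (suc k) ≡ g (suc k)) → ∀ n → sumFrom1 n f ≡ sumFrom1 n g
sumFrom1-cong f≗g zero    = refl
sumFrom1-cong f≗g (suc n) = cong₂ _+_ (sumFrom1-cong f≗g n) (f≗g n)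

-- T (x (x + 1)) k = (-x)ₖ (x + 1)ₖ / k!²
T : ℚ → ℕ → ℚ
T w zero    = 1ℚ
T w (suc k) = T w k * (ℚ[ k ] * (ℚ[ k ] + 1ℚ) - w) * (recip (suc k) * recip (suc k))

-- B x k = (-x)ₖ (x)ₖ / k!²
B : ℚ → ℕ → ℚ
B x zero    = 1ℚ
B x (suc k) = B x k * (ℚ[ k ] * ℚ[ k ] - x * x) * (recip (suc k) * recip (suc k))

-- The product of 1 - x²/j² over 1 ≤ j ≤ N: Euler's product for sin(πx)/(πx), truncated.
P : ℚ → ℕ → ℚ
P x zero    = 1ℚ
P x (suc N) = P x N * (1ℚ - x * x * (recip (suc N) * recip (suc N)))

S₁ S₂ : ℚ → ℕ → ℚ
S₁ w N = sumFrom1 N (λ k → T w k * recip k)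
S₂ w N = sumFrom1 N (λ k → T w k * (recip k * recip k))

-- The two terms share (-x)ₖ, and x (x + 1)ₖ = (x + k) (x)ₖ.
T-B⁺ : ∀ x k → x * T (x * (x + 1ℚ)) k ≡ (x + ℚ[ k ]) * B x k
T-B⁺ x zero    = ring x
  where
  ring : ∀ x → x * 1ℚ ≡ (x + ℚ[ 0 ]) * 1ℚ
  ring = solve-∀ ℚ-ring
T-B⁺ x (suc k) = ≡-modulo (ring x ℚ[ k ] ℚ[ suc k ] _ _ (recip (suc k)))
                   (vanish (T-B⁺ x k) ⊞ vanish (ℚ[]-suc k))
  where
  ring : ∀ x k k′ t b r →
    x * (t * (k * (k + 1ℚ) - x * (x + 1ℚ)) * (r * r)) ≡
    (x + k′) * (b * (k * k - x * x) * (r * r))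
    + ((x * t - (x + k) * b) * ((k * (k + 1ℚ) - x * (x + 1ℚ)) * (r * r))
       + (k′ - (k + 1ℚ)) * (- (b * (k * k - x * x) * (r * r))))
  ring = solve-∀ ℚ-ring

-- With x = y + 1 the two terms share (x)ₖ, and x (-y)ₖ = (x - k) (-x)ₖ. Thus the same `B x k`
-- governs `T` at x and at x - 1.
T-B⁻ : ∀ y k → (y + 1ℚ) * T (y * (y + 1ℚ)) k ≡ (y + 1ℚ - ℚ[ k ]) * B (y + 1ℚ) k
T-B⁻ y zero    = ring y
  where
  ring : ∀ y → (y + 1ℚ) * 1ℚ ≡ (y + 1ℚ - ℚ[ 0 ]) * 1ℚ
  ring = solve-∀ ℚ-ring
T-B⁻ y (suc k) = ≡-modulo (ring y ℚ[ k ] ℚ[ suc k ] _ _ (recip (suc k)))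
                   (vanish (T-B⁻ y k) ⊞ vanish (ℚ[]-suc k))
  where
  ring : ∀ y k k′ t b r →
    (y + 1ℚ) * (t * (k * (k + 1ℚ) - y * (y + 1ℚ)) * (r * r)) ≡
    (y + 1ℚ - k′) * (b * (k * k - (y + 1ℚ) * (y + 1ℚ)) * (r * r))
    + (((y + 1ℚ) * t - (y + 1ℚ - k) * b) * ((k * (k + 1ℚ) - y * (y + 1ℚ)) * (r * r))
       + (k′ - (k + 1ℚ)) * (b * (k * k - (y + 1ℚ) * (y + 1ℚ)) * (r * r)))
  ring = solve-∀ ℚ-ring

-- The right-hand side is the increment `P x (suc N) - P x N`, which is what makes `sum-B`
-- telescope.
B-P : ∀ x N → B x (suc N) ≡ - (x * x * (recip (suc N) * recip (suc N))) * P x N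
B-P x zero    = ring x (recip 1)
  where
  ring : ∀ x r → 1ℚ * (ℚ[ 0 ] * ℚ[ 0 ] - x * x) * (r * r) ≡ - (x * x * (r * r)) * 1ℚ
  ring = solve-∀ ℚ-ring
B-P x (suc N) = ≡-modulo (ring x ℚ[ suc N ] (recip (suc N)) (recip (suc (suc N))) (B x (suc N)) (P x N))
                  (vanish (B-P x N) ⊞ vanish (*-recip N))
  where
  ring : ∀ x k r s b q →
    b * (k * k - x * x) * (s * s) ≡
    - (x * x * (s * s)) * (q * (1ℚ - x * x * (r * r)))
    + ((b - - (x * x * (r * r)) * q) * ((k * k - x * x) * (s * s))
       + (k * r - 1ℚ) * (- (x * x * (s * s) * q * (k * r + 1ℚ))))
  ring = solve-∀ ℚ-ring

sum-B : ∀ x N → 1ℚ + sumFrom1 N (B x) ≡ P x N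
sum-B x zero    = refl
sum-B x (suc N) = ≡-modulo (ring x (recip (suc N)) (B x (suc N)) (sumFrom1 N (B x)) (P x N))
                    (vanish (sum-B x N) ⊞ vanish (B-P x N))
  where
  ring : ∀ x r b s q →
    1ℚ + (s + b) ≡
    q * (1ℚ - x * x * (r * r))
    + ((1ℚ + s - q) * 1ℚ + (b - - (x * x * (r * r)) * q) * 1ℚ)
  ring = solve-∀ ℚ-ring

-- Subtracting `T-B⁻` from `T-B⁺` gives 2k `B x k`; the weight 1/k cancels the k, and `sum-B`
-- evaluates what is left.
S₁-difference : ∀ y N → let x = y + 1ℚ in
  x * (S₁ (x * (x + 1ℚ)) N - S₁ (y * x) N) ≡ ℚ[ 2 ] * (P x N - 1ℚ)
S₁-difference y N = trans (go N) (trans (ring₂ (sumFrom1 N (B (y + 1ℚ))))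
                                        (cong (λ z → ℚ[ 2 ] * (z - 1ℚ)) (sum-B (y + 1ℚ) N)))
  where
  x = y + 1ℚ
  ring₀ : ∀ x → x * (0ℚ - 0ℚ) ≡ ℚ[ 2 ] * 0ℚ
  ring₀ = solve-∀ ℚ-ring
  ring₁ : ∀ x k r s s′ t t′ b σ →
    x * (s + t * r - (s′ + t′ * r)) ≡
    ℚ[ 2 ] * (σ + b)
    + ((x * (s - s′) - ℚ[ 2 ] * σ) * 1ℚ + (x * t - (x + k) * b) * r
       + (x * t′ - (x - k) * b) * (- r) + (k * r - 1ℚ) * (ℚ[ 2 ] * b))
  ring₁ = solve-∀ ℚ-ring
  ring₂ : ∀ σ → ℚ[ 2 ] * σ ≡ ℚ[ 2 ] * (1ℚ + σ - 1ℚ)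
  ring₂ = solve-∀ ℚ-ring
  go : ∀ N → x * (S₁ (x * (x + 1ℚ)) N - S₁ (y * x) N) ≡ ℚ[ 2 ] * sumFrom1 N (B x)
  go zero    = ring₀ x
  go (suc k) = ≡-modulo (ring₁ x ℚ[ suc k ] (recip (suc k)) (S₁ (x * (x + 1ℚ)) k) (S₁ (y * x) k)
                                  (T (x * (x + 1ℚ)) (suc k)) (T (y * x) (suc k)) (B x (suc k)) (sumFrom1 k (B x)))
                 (vanish (go k) ⊞ vanish (T-B⁺ x (suc k)) ⊞ vanish (T-B⁻ y (suc k)) ⊞ vanish (*-recip k))

-- Termwise: with t and t′ the values of `T` at x and y, x (t - t′) = 2k `B x k` and x (t + t′) = 2x
-- `B x k`, so x² (t - t′)/k² = x (t + t′)/k.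
S₂-difference : ∀ y N → let x = y + 1ℚ in
  x * x * (S₂ (x * (x + 1ℚ)) N - S₂ (y * x) N) ≡ x * (S₁ (x * (x + 1ℚ)) N + S₁ (y * x) N)
S₂-difference y zero    = ring (y + 1ℚ)
  where
  ring : ∀ x → x * x * (0ℚ - 0ℚ) ≡ x * (0ℚ + 0ℚ)
  ring = solve-∀ ℚ-ring
S₂-difference y (suc k) =
  ≡-modulo (ring x ℚ[ suc k ] (recip (suc k)) (S₂ (x * (x + 1ℚ)) k) (S₂ (y * x) k)
                 (T (x * (x + 1ℚ)) (suc k)) (T (y * x) (suc k)) (S₁ (x * (x + 1ℚ)) k) (S₁ (y * x) k) (B x (suc k)))
    (vanish (S₂-difference y k) ⊞ vanish (T-B⁺ x (suc k)) ⊞ vanish (T-B⁻ y (suc k)) ⊞ vanish (*-recip k))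
  where
  x = y + 1ℚ
  ring : ∀ x k r s s′ t t′ σ σ′ b →
    x * x * (s + t * (r * r) - (s′ + t′ * (r * r))) ≡
    x * (σ + t * r + (σ′ + t′ * r))
    + ((x * x * (s - s′) - x * (σ + σ′)) * 1ℚ
       + (x * t - (x + k) * b) * (x * (r * r) - r)
       + (x * t′ - (x - k) * b) * (- (x * (r * r)) - r)
       + (k * r - 1ℚ) * (ℚ[ 2 ] * x * b * r))
  ring = solve-∀ ℚ-ring

-- Write 1 - y²/j² = (j - y)(j + y)/j²: replacing y by y + 1 shifts both runs of linear factors by
-- one place, so only their end factors change.
P-shift : ∀ y N → P (y + 1ℚ) N * (y - ℚ[ N ]) * (y + 1ℚ) ≡ P y N * y * (y + 1ℚ + ℚ[ N ])
P-shift y zero    = ring y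
  where
  ring : ∀ y → 1ℚ * (y - ℚ[ 0 ]) * (y + 1ℚ) ≡ 1ℚ * y * (y + 1ℚ + ℚ[ 0 ])
  ring = solve-∀ ℚ-ring
P-shift y (suc N) = ≡-modulo (ring y ℚ[ N ] ℚ[ suc N ] (recip (suc N)) (P (y + 1ℚ) N) (P y N))
                      (vanish (P-shift y N) ⊞ vanish (*-recip N) ⊞ vanish (ℚ[]-suc N))
  where
  ring : ∀ y n n′ r q′ q →
    q′ * (1ℚ - (y + 1ℚ) * (y + 1ℚ) * (r * r)) * (y - n′) * (y + 1ℚ) ≡
    q * (1ℚ - y * y * (r * r)) * y * (y + 1ℚ + n′)
    + ((q′ * (y - n) * (y + 1ℚ) - q * y * (y + 1ℚ + n)) * (- ((y - n′) * (n′ + y + 1ℚ) * (r * r)))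
       + (n′ * r - 1ℚ) * (- ((n′ * r + 1ℚ) * (q′ * (y - n′) * (y + 1ℚ) - q * y * (y + 1ℚ + n′))))
       + (n′ - (n + 1ℚ)) * (r * r * (n′ + y + 1ℚ) * (y - n′) * (q′ * (y + 1ℚ) + q * y)))
  ring = solve-∀ ℚ-ring

-- Zeros of `P` and exact values of the sums at natural x.

P-root : ∀ {n N} → suc n ℕ.≤ N → P ℚ[ suc n ] N ≡ 0ℚ
P-root {n} {suc N} n≤N with ℕₚ.m≤n⇒m<n∨m≡n n≤N
... | inj₁ (s≤s n<N) = *-vanishˡ (1ℚ - ℚ[ suc n ] * ℚ[ suc n ] * (recip (suc N) * recip (suc N))) (P-root n<N)
... | inj₂ refl = ≡-modulo (ring ℚ[ suc n ] (recip (suc n)) (P ℚ[ suc n ] n)) (vanish (*-recip n))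
  where
  ring : ∀ k r q → q * (1ℚ - k * k * (r * r)) ≡ 0ℚ + (k * r - 1ℚ) * (- (q * (k * r + 1ℚ)))
  ring = solve-∀ ℚ-ring

-- The factor j = 0 already vanishes. The argument keeps the shape n (n + 1) at n = 0, as the base
-- cases below require it.
T-at-0 : ∀ k → T (ℚ[ 0 ] * (ℚ[ 0 ] + 1ℚ)) (suc k) ≡ 0ℚ
T-at-0 zero    = ring (recip 1)
  where
  ring : ∀ r → 1ℚ * (ℚ[ 0 ] * (ℚ[ 0 ] + 1ℚ) - ℚ[ 0 ] * (ℚ[ 0 ] + 1ℚ)) * (r * r) ≡ 0ℚ
  ring = solve-∀ ℚ-ring
T-at-0 (suc k) = ≡-modulo (ring (T _ (suc k)) (ℚ[ suc k ] * (ℚ[ suc k ] + 1ℚ) - ℚ[ 0 ] * (ℚ[ 0 ] + 1ℚ)) (recip (suc (suc k))))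
                   (vanish (T-at-0 k))
  where
  ring : ∀ t a r → t * a * (r * r) ≡ 0ℚ + (t - 0ℚ) * (a * (r * r))
  ring = solve-∀ ℚ-ring

sumFrom1-zero : ∀ {f} → (∀ k → f (suc k) ≡ 0ℚ) → ∀ n → sumFrom1 n f ≡ 0ℚ
sumFrom1-zero f≗0 zero    = refl
sumFrom1-zero f≗0 (suc n) = cong₂ _+_ (sumFrom1-zero f≗0 n) (f≗0 n)

-- Since `P` vanishes at n + 1 ≤ N, `S₁-difference` says that passing from n to n + 1 adds -2/(n +
-- 1).
S₁-at-ℕ : ∀ n N → n ℕ.≤ N → S₁ (ℚ[ n ] * (ℚ[ n ] + 1ℚ)) N ≡ - (ℚ[ 2 ] * H n)
S₁-at-ℕ zero    N _   = sumFrom1-zero (λ k → *-vanishˡ (recip (suc k)) (T-at-0 k)) N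
S₁-at-ℕ (suc n) N n<N = ≡-modulo (ring ℚ[ suc n ] (recip (suc n)) (S₁ _ N) (S₁ _ N) (H n) (P ℚ[ suc n ] N))
    (vanish (subst (λ x → x * (S₁ (x * (x + 1ℚ)) N - S₁ (ℚ[ n ] * (ℚ[ n ] + 1ℚ)) N) ≡ ℚ[ 2 ] * (P x N - 1ℚ))
                   (sym (ℚ[]-suc n)) (S₁-difference ℚ[ n ] N))
     ⊞ vanish (*-recip n) ⊞ vanish (S₁-at-ℕ n N (ℕₚ.<⇒≤ n<N)) ⊞ vanish (P-root n<N))
  where
  ring : ∀ x r s s′ h q →
    s ≡ - (ℚ[ 2 ] * (h + r))
      + ((x * (s - s′) - ℚ[ 2 ] * (q - 1ℚ)) * r
         + (x * r - 1ℚ) * (- (s - s′))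
         + (s′ - - (ℚ[ 2 ] * h)) * 1ℚ
         + (q - 0ℚ) * (ℚ[ 2 ] * r))
  ring = solve-∀ ℚ-ring

-- By `S₂-difference` and `S₁-at-ℕ` the increment is -2 (H (n + 1) + H n)/(n + 1), a difference of
-- squares because 1/(n + 1) = H (n + 1) - H n.
S₂-at-ℕ : ∀ n N → n ℕ.≤ N → S₂ (ℚ[ n ] * (ℚ[ n ] + 1ℚ)) N ≡ - (ℚ[ 2 ] * (H n * H n))
S₂-at-ℕ zero    N _   = sumFrom1-zero (λ k → *-vanishˡ (recip (suc k) * recip (suc k)) (T-at-0 k)) N
S₂-at-ℕ (suc n) N n<N = ≡-modulo (ring ℚ[ suc n ] (recip (suc n)) (S₂ _ N) (S₂ _ N) (S₁ _ N) (S₁ _ N) (H n))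
    (vanish (subst (λ x → x * x * (S₂ (x * (x + 1ℚ)) N - S₂ (ℚ[ n ] * (ℚ[ n ] + 1ℚ)) N)
                          ≡ x * (S₁ (x * (x + 1ℚ)) N + S₁ (ℚ[ n ] * (ℚ[ n ] + 1ℚ)) N))
                   (sym (ℚ[]-suc n)) (S₂-difference ℚ[ n ] N))
     ⊞ vanish (*-recip n) ⊞ vanish (S₂-at-ℕ n N (ℕₚ.<⇒≤ n<N))
     ⊞ vanish (S₁-at-ℕ n N (ℕₚ.<⇒≤ n<N)) ⊞ vanish (S₁-at-ℕ (suc n) N n<N))
  where
  ring : ∀ x r s s′ σ σ′ h →
    s ≡ - (ℚ[ 2 ] * ((h + r) * (h + r)))
      + ((x * x * (s - s′) - x * (σ + σ′)) * (r * r)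
         + (x * r - 1ℚ) * (- ((x * r + 1ℚ) * (s - s′)) + r * (σ + σ′))
         + (s′ - - (ℚ[ 2 ] * (h * h))) * 1ℚ
         + (σ′ - - (ℚ[ 2 ] * h)) * r
         + (σ - - (ℚ[ 2 ] * (h + r))) * r)
  ring = solve-∀ ℚ-ring

-- The Pochhammer quotient of the statement as a value of `T`.

-- The witness is 1/k!. The second part rests on j (j + 1) + 1/4 = (j + 1/2)².
poch-1-inverse : ∀ k → ∃[ q ] poch ℚ[ 1 ] k * q ≡ 1ℚ ×
                              T (- (half * half)) k ≡ poch half k * poch half k * (q * q)
poch-1-inverse zero    = 1ℚ , refl , refl
poch-1-inverse (suc k) with poch-1-inverse k
... | q , 1ₖq≡1 , T≡ = q * recip (suc k)
  , ≡-modulo (ring₁ (poch ℚ[ 1 ] k) ℚ[ k ] ℚ[ suc k ] q (recip (suc k))) (vanish 1ₖq≡1 ⊞ vanish (*-recip k) ⊞ vanish (ℚ[]-suc k))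
  , ≡-modulo (ring₂ (poch half k) ℚ[ k ] q (recip (suc k)) (T _ k)) (vanish T≡)
  where
  ring₁ : ∀ f k k′ q r →
    f * (ℚ[ 1 ] + k) * (q * r) ≡
    1ℚ + ((f * q - 1ℚ) * (k′ * r) + (k′ * r - 1ℚ) * 1ℚ + (k′ - (k + 1ℚ)) * (- (f * q * r)))
  ring₁ = solve-∀ ℚ-ring
  ring₂ : ∀ f k q r t →
    t * (k * (k + 1ℚ) - - (half * half)) * (r * r) ≡
    f * (half + k) * (f * (half + k)) * (q * r * (q * r))
    + (t - f * f * (q * q)) * ((half + k) * (half + k) * (r * r))
  ring₂ = solve-∀ ℚ-ring

poch-quotient : ∀ k → (poch half k * poch half k) ÷ (poch ℚ[ 1 ] k * poch ℚ[ 1 ] k) ≡ T (- (half * half)) k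
poch-quotient k with poch-1-inverse k
... | q , 1ₖq≡1 , T≡ = trans (÷≡* (poch half k * poch half k) {poch ℚ[ 1 ] k * poch ℚ[ 1 ] k} {q * q}
                                 (squares-inverse (poch ℚ[ 1 ] k) q 1ₖq≡1)) (sym T≡)

recip-square : ∀ k → 1ℚ ÷ (ℚ[ suc k ] * ℚ[ suc k ]) ≡ recip (suc k) * recip (suc k)
recip-square k = trans (÷≡* 1ℚ {ℚ[ suc k ] * ℚ[ suc k ]} {recip (suc k) * recip (suc k)}
                            (squares-inverse ℚ[ suc k ] (recip (suc k)) (*-recip k)))
                       (ℚₚ.*-identityˡ (recip (suc k) * recip (suc k)))

-- Rationals modulo powers of p.

module PAdic {p : ℕ} (prime : Prime p) where

  instance _ = prime⇒nonZero prime

  -- Membership in the localisation of ℤ at p. Any denominator prime to p is accepted, reduced or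
  -- not, so closure under sums and products involves no cancellation.
  record Integral (x : ℚ) : Set where
    constructor integral
    field
      denominator : ℕ
      p∤denominator : ¬ p ∣ denominator
      numerator : ℤ
      cleared : x * ℚ[ denominator ] ≡ fromℤ numerator

  -- Membership in the ideal generated by p^s in that localisation. Below, `⊗` adds exponents, so
  -- the index of a compound term records its valuation bound by computation.
  record Multiple (s : ℕ) (x : ℚ) : Set where
    constructor multiple
    field
      {quotient} : ℚ
      quotient-integral : Integral quotient
      factored : x ≡ ℚ[ p ℕ.^ s ] * quotient

  ∤-* : ∀ {m n} → ¬ p ∣ m → ¬ p ∣ n → ¬ p ∣ m ℕ.* n
  ∤-* {m} {n} p∤m p∤n p∣mn with euclidsLemma m n prime p∣mn
  ... | inj₁ p∣m = p∤m p∣m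
  ... | inj₂ p∣n = p∤n p∣n

  integral-+ : ∀ {x y} → Integral x → Integral y → Integral (x + y)
  integral-+ {x} {y} (integral m p∤m i xm≡i) (integral n p∤n j yn≡j) =
    integral (m ℕ.* n) (∤-* p∤m p∤n) (i ℤ.* + n ℤ.+ j ℤ.* + m) (begin
      (x + y) * ℚ[ m ℕ.* n ]                             ≡⟨ cong ((x + y) *_) (ℚ[]-* m n) ⟩
      (x + y) * (ℚ[ m ] * ℚ[ n ])                        ≡⟨ ring x y ℚ[ m ] ℚ[ n ] ⟩
      x * ℚ[ m ] * ℚ[ n ] + y * ℚ[ n ] * ℚ[ m ]          ≡⟨ cong₂ (λ a b → a * ℚ[ n ] + b * ℚ[ m ]) xm≡i yn≡j ⟩
      fromℤ i * ℚ[ n ] + fromℤ j * ℚ[ m ]                ≡⟨ cong₂ _+_ (fromℤ-* i (+ n)) (fromℤ-* j (+ m)) ⟨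
      fromℤ (i ℤ.* + n) + fromℤ (j ℤ.* + m)              ≡⟨ fromℤ-+ (i ℤ.* + n) (j ℤ.* + m) ⟨
      fromℤ (i ℤ.* + n ℤ.+ j ℤ.* + m)                    ∎)
    where
    open ≡-Reasoning
    ring : ∀ x y m n → (x + y) * (m * n) ≡ x * m * n + y * n * m
    ring = solve-∀ ℚ-ring

  integral-* : ∀ {x y} → Integral x → Integral y → Integral (x * y)
  integral-* {x} {y} (integral m p∤m i xm≡i) (integral n p∤n j yn≡j) =
    integral (m ℕ.* n) (∤-* p∤m p∤n) (i ℤ.* j) (begin
      x * y * ℚ[ m ℕ.* n ]           ≡⟨ cong (x * y *_) (ℚ[]-* m n) ⟩
      x * y * (ℚ[ m ] * ℚ[ n ])      ≡⟨ ring x y ℚ[ m ] ℚ[ n ] ⟩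
      x * ℚ[ m ] * (y * ℚ[ n ])      ≡⟨ cong₂ _*_ xm≡i yn≡j ⟩
      fromℤ i * fromℤ j              ≡⟨ fromℤ-* i j ⟨
      fromℤ (i ℤ.* j)                ∎)
    where
    open ≡-Reasoning
    ring : ∀ x y m n → x * y * (m * n) ≡ x * m * (y * n)
    ring = solve-∀ ℚ-ring

  p∤1 : ¬ p ∣ 1
  p∤1 p∣1 with prime⇒nonTrivial prime | ∣1⇒≡1 p∣1
  ... | () | refl

  integral-fromℤ : ∀ i → Integral (fromℤ i)
  integral-fromℤ i = integral 1 p∤1 i (ℚₚ.*-identityʳ (fromℤ i))

  multiple-resp : ∀ {s x y} → x ≡ y → Multiple s x → Multiple s y
  multiple-resp refl mx = mx

  integral⇒multiple : ∀ {x} → Integral x → Multiple 0 x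
  integral⇒multiple ix = multiple ix (sym (ℚₚ.*-identityˡ _))

  multiple-constant : ∀ i → Multiple 0 (fromℤ i)
  multiple-constant i = integral⇒multiple (integral-fromℤ i)

  multiple-ℕ : ∀ n → Multiple 0 ℚ[ n ]
  multiple-ℕ n = multiple-constant (+ n)

  multiple-p : Multiple 1 ℚ[ p ]
  multiple-p = multiple (integral-fromℤ 1ℤ)
    (trans (cong ℚ[_] (sym (ℕₚ.*-identityʳ p))) (sym (ℚₚ.*-identityʳ ℚ[ p ℕ.^ 1 ])))

  infixl 6 _⊕_ _⊖_
  infixl 7 _⊗_

  _⊕_ : ∀ {s x y} → Multiple s x → Multiple s y → Multiple s (x + y)
  _⊕_ {s} (multiple {x} ix refl) (multiple {y} iy refl) =
    multiple (integral-+ ix iy) (sym (ℚₚ.*-distribˡ-+ ℚ[ p ℕ.^ s ] x y))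

  _⊗_ : ∀ {s t x y} → Multiple s x → Multiple t y → Multiple (s ℕ.+ t) (x * y)
  _⊗_ {s} {t} (multiple {x} ix refl) (multiple {y} iy refl) = multiple (integral-* ix iy)
    (trans (ring ℚ[ p ℕ.^ s ] x ℚ[ p ℕ.^ t ] y)
           (cong (_* (x * y)) (trans (sym (ℚ[]-* (p ℕ.^ s) (p ℕ.^ t))) (cong ℚ[_] (sym (ℕₚ.^-distribˡ-+-* p s t))))))
    where
    ring : ∀ a x b y → a * x * (b * y) ≡ a * b * (x * y)
    ring = solve-∀ ℚ-ring

  multiple-neg : ∀ {s x} → Multiple s x → Multiple s (- x)
  multiple-neg {s} {x} mx = multiple-resp (ring x) (multiple-constant (ℤ.- 1ℤ) ⊗ mx)
    where
    ring : ∀ x → fromℤ (ℤ.- 1ℤ) * x ≡ - x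
    ring = solve-∀ ℚ-ring

  _⊖_ : ∀ {s x y} → Multiple s x → Multiple s y → Multiple s (x - y)
  mx ⊖ my = mx ⊕ multiple-neg my

  multiple-suc : ∀ {s x} → Multiple (suc s) x → Multiple s x
  multiple-suc {s} (multiple {x} ix refl) = multiple (integral-* (integral-fromℤ (+ p)) ix)
    (trans (cong (_* x) (ℚ[]-* p (p ℕ.^ s))) (ring ℚ[ p ] ℚ[ p ℕ.^ s ] x))
    where
    ring : ∀ p q x → p * q * x ≡ q * (p * x)
    ring = solve-∀ ℚ-ring

  multiple-recip : ∀ {n} → ¬ p ∣ n → Multiple 0 (recip n)
  multiple-recip {zero}  p∤0 = contradiction (p ∣0) p∤0
  multiple-recip {suc n} p∤n = integral⇒multiple (integral (suc n) p∤n 1ℤ (trans (ℚₚ.*-comm _ ℚ[ suc n ]) (*-recip n)))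

  multiple-cancel : ∀ {s x n} → ¬ p ∣ suc n → Multiple s (x * ℚ[ suc n ]) → Multiple s x
  multiple-cancel {x = x} {n} p∤n mx =
    multiple-resp (≡-modulo (ring x ℚ[ suc n ] (recip (suc n))) (vanish (*-recip n))) (multiple-recip p∤n ⊗ mx)
    where
    ring : ∀ x n r → r * (x * n) ≡ x + (n * r - 1ℚ) * x
    ring = solve-∀ ℚ-ring

  ^-∣-cancel : ∀ s {a n} → ¬ p ∣ n → p ℕ.^ s ∣ a ℕ.* n → p ℕ.^ s ∣ a
  ^-∣-cancel zero    p∤n _ = 1∣ _
  ^-∣-cancel (suc s) {a} {n} p∤n pˢ∣an with euclidsLemma a n prime (∣-trans (m∣m*n (p ℕ.^ s)) pˢ∣an)
  ... | inj₂ p∣n = contradiction p∣n p∤n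
  ... | inj₁ (divides b refl) = subst (p ℕ.^ suc s ∣_) (ℕₚ.*-comm p b) (*-monoʳ-∣ p
        (^-∣-cancel s p∤n (*-cancelˡ-∣ p (subst (p ℕ.^ suc s ∣_) (trans (cong (ℕ._* n) (ℕₚ.*-comm b p)) (ℕₚ.*-assoc p b n)) pˢ∣an))))

  -- For d = a/b reduced, clearing denominators gives a n = p^s z b with n prime to p. Hence p^s
  -- divides a; and b divides a n, so by coprimality b divides n and is prime to p.
  multiple⇒mod : ∀ {s} u v → Multiple s (u - v) → u ≡ v [mod p ^ s ]
  multiple⇒mod {s} u v (multiple {y} (integral n p∤n z yn≡z) d≡pˢy) =
    inj₂ (^-∣-cancel s p∤n (divides-refl′ (trans eq′ (ℕₚ.*-assoc (p ℕ.^ s) ℤ.∣ z ∣ (↧ₙ d)))) ,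
          λ p∣↧d → p∤n (∣-trans p∣↧d (coprime-divisor (Coprimality.sym coprime) (divides (p ℕ.^ s ℕ.* ℤ.∣ z ∣) eq′))))
    where
    d = u - v
    divides-refl′ : ∀ {a b c} → a ≡ b ℕ.* c → b ∣ a
    divides-refl′ {b = b} {c} eq = divides c (trans eq (ℕₚ.*-comm b c))
    coprime : Coprime ℤ.∣ ↥ d ∣ (↧ₙ d)
    coprime with d
    ... | ℚ.mkℚ _ _ c = Coprimality.recompute c
    ring : ∀ d e n y z q →
      d * n * e ≡ q * z * e + ((y * n - z) * (q * e) + (d - q * y) * (n * e))
    ring = solve-∀ ℚ-ring
    open ≡-Reasoning
    eq : ↥ d ℤ.* + n ≡ + (p ℕ.^ s) ℤ.* z ℤ.* ↧ d
    eq = fromℤ-injective (begin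
      fromℤ (↥ d ℤ.* + n)                           ≡⟨ fromℤ-* (↥ d) (+ n) ⟩
      fromℤ (↥ d) * ℚ[ n ]                          ≡⟨ cong (_* ℚ[ n ]) (p*↧p≡↥p d) ⟨
      d * ℚ[ ↧ₙ d ] * ℚ[ n ]                        ≡⟨ trans (ℚₚ.*-assoc d _ _) (trans (cong (d *_) (ℚₚ.*-comm ℚ[ ↧ₙ d ] ℚ[ n ])) (sym (ℚₚ.*-assoc d _ _))) ⟩
      d * ℚ[ n ] * ℚ[ ↧ₙ d ]                        ≡⟨ ≡-modulo (ring d ℚ[ ↧ₙ d ] ℚ[ n ] y (fromℤ z) ℚ[ p ℕ.^ s ]) (vanish yn≡z ⊞ vanish d≡pˢy) ⟩
      ℚ[ p ℕ.^ s ] * fromℤ z * ℚ[ ↧ₙ d ]            ≡⟨ cong (_* ℚ[ ↧ₙ d ]) (fromℤ-* (+ (p ℕ.^ s)) z) ⟨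
      fromℤ (+ (p ℕ.^ s) ℤ.* z) * ℚ[ ↧ₙ d ]         ≡⟨ fromℤ-* (+ (p ℕ.^ s) ℤ.* z) (↧ d) ⟨
      fromℤ (+ (p ℕ.^ s) ℤ.* z ℤ.* ↧ d)             ∎)
    eq′ : ℤ.∣ ↥ d ∣ ℕ.* n ≡ p ℕ.^ s ℕ.* ℤ.∣ z ∣ ℕ.* ↧ₙ d
    eq′ = begin
      ℤ.∣ ↥ d ∣ ℕ.* n                                ≡⟨ ℤₚ.abs-* (↥ d) (+ n) ⟨
      ℤ.∣ ↥ d ℤ.* + n ∣                              ≡⟨ cong ℤ.∣_∣ eq ⟩
      ℤ.∣ + (p ℕ.^ s) ℤ.* z ℤ.* ↧ d ∣                ≡⟨ ℤₚ.abs-* (+ (p ℕ.^ s) ℤ.* z) (↧ d) ⟩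
      ℤ.∣ + (p ℕ.^ s) ℤ.* z ∣ ℕ.* ↧ₙ d               ≡⟨ cong (ℕ._* ↧ₙ d) (ℤₚ.abs-* (+ (p ℕ.^ s)) z) ⟩
      p ℕ.^ s ℕ.* ℤ.∣ z ∣ ℕ.* ↧ₙ d                   ∎

-- The product `P` at and near x = p, where p = N + 1.

module Congruences {N : ℕ} (prime : Prime (suc N)) where

  open PAdic prime

  𝐩 : ℚ
  𝐩 = ℚ[ suc N ]

  -- The harmonic number of order two, not the square of `H`.
  H² : ℕ → ℚ
  H² n = sumFrom1 n (λ k → recip k * recip k)

  F : ℚ → ℚ
  F y = S₁ (y * (y + 1ℚ)) N

  -- The equation on `x` lets `ℚ[ suc n ]` stand for `ℚ[ n ] + 1ℚ`, to which it does not reduce.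
  F-difference : ∀ y {x} → x ≡ y + 1ℚ → x * (F x - F y) ≡ ℚ[ 2 ] * (P x N - 1ℚ)
  F-difference y refl = S₁-difference y N

  multiple-cancel-p : ∀ {s x} → Multiple (suc s) (𝐩 * x) → Multiple s x
  multiple-cancel-p {s} {x} (multiple {y} iy px≡) = multiple iy
    (≡-modulo (ring 𝐩 (recip (suc N)) x ℚ[ suc N ℕ.^ s ] ℚ[ suc N ℕ.^ suc s ] y)
      (vanish px≡ ⊞ vanish (ℚ[]-* (suc N) (suc N ℕ.^ s)) ⊞ vanish (*-recip N)))
    where
    ring : ∀ p r x q q′ y →
      x ≡ q * y + ((p * x - q′ * y) * r + (q′ - p * q) * (y * r) + (p * r - 1ℚ) * (q * y - x))
    ring = solve-∀ ℚ-ring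

  p∤-≤ : ∀ {k} → suc k ℕ.≤ N → ¬ suc N ∣ suc k
  p∤-≤ k<N = >⇒∤ (s≤s k<N)

  p∤-+ : ∀ {k} → suc k ℕ.≤ N → ¬ suc N ∣ suc N ℕ.+ suc k
  p∤-+ k<N p∣ = p∤-≤ k<N (∣m+n∣m⇒∣n p∣ ∣-refl)

  multiple-recip² : ∀ {k} → suc k ℕ.≤ N → Multiple 0 (recip (suc k) * recip (suc k))
  multiple-recip² k<N = multiple-recip (p∤-≤ k<N) ⊗ multiple-recip (p∤-≤ k<N)

  multiple-H² : ∀ {n} → n ℕ.≤ N → Multiple 0 (H² n)
  multiple-H² {zero}  _   = multiple-ℕ 0
  multiple-H² {suc n} n<N = multiple-H² (ℕₚ.<⇒≤ n<N) ⊕ multiple-recip² n<N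

  -- Expand the product in powers of p²: beyond the linear term every term carries p⁴.
  P-at-p : ∀ {n} → n ℕ.≤ N → Multiple 4 (P 𝐩 n - (1ℚ - 𝐩 * 𝐩 * H² n))
  P-at-p {zero}  _   = multiple-resp (ring 𝐩) (multiple-p ⊗ multiple-p ⊗ multiple-p ⊗ multiple-p ⊗ multiple-ℕ 0)
    where
    ring : ∀ p → p * p * p * p * 0ℚ ≡ 1ℚ - (1ℚ - p * p * 0ℚ)
    ring = solve-∀ ℚ-ring
  P-at-p {suc n} n<N = multiple-resp (ring 𝐩 (P 𝐩 n) (H² n) (recip (suc n)))
    (P-at-p (ℕₚ.<⇒≤ n<N) ⊗ (multiple-ℕ 1 ⊖ multiple-ℕ (suc N) ⊗ multiple-ℕ (suc N) ⊗ multiple-recip² n<N)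
     ⊕ multiple-p ⊗ multiple-p ⊗ multiple-p ⊗ multiple-p ⊗ (multiple-H² (ℕₚ.<⇒≤ n<N) ⊗ multiple-recip² n<N))
    where
    ring : ∀ p q h r →
      (q - (1ℚ - p * p * h)) * (1ℚ - p * p * (r * r)) + p * p * p * p * (h * (r * r)) ≡
      q * (1ℚ - p * p * (r * r)) - (1ℚ - p * p * (h + r * r))
    ring = solve-∀ ℚ-ring

  -- This is `P-shift` at y = p + a, where y - N = a + 1 and y + 1 + N = 2p + a.
  P-near-p-step : ∀ a →
    P (𝐩 + ℚ[ suc a ]) N * ℚ[ suc a ] * (𝐩 + ℚ[ suc a ])
      ≡ P (𝐩 + ℚ[ a ]) N * (𝐩 + ℚ[ a ]) * (ℚ[ 2 ] * 𝐩 + ℚ[ a ])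
  P-near-p-step a = subst₂ (λ x a⁺ → P x N * a⁺ * x ≡ P (𝐩 + ℚ[ a ]) N * (𝐩 + ℚ[ a ]) * (ℚ[ 2 ] * 𝐩 + ℚ[ a ]))
      (trans (ℚₚ.+-assoc 𝐩 ℚ[ a ] 1ℚ) (cong (λ z → 𝐩 + z) (sym (ℚ[]-suc a)))) (sym (ℚ[]-suc a))
      (≡-modulo (ring (P (𝐩 + ℚ[ a ] + 1ℚ) N) (P (𝐩 + ℚ[ a ]) N) 𝐩 ℚ[ N ] ℚ[ a ])
        (vanish (P-shift (𝐩 + ℚ[ a ]) N) ⊞ vanish (ℚ[]-suc N)))
    where
    ring : ∀ q′ q p n a →
      q′ * (a + 1ℚ) * (p + a + 1ℚ) ≡
      q * (p + a) * (ℚ[ 2 ] * p + a)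
      + ((q′ * (p + a - n) * (p + a + 1ℚ) - q * (p + a) * (p + a + 1ℚ + n)) * 1ℚ
         + (p - (n + 1ℚ)) * (- (q′ * (p + a + 1ℚ)) - q * (p + a)))
    ring = solve-∀ ℚ-ring

  P-at-p≈1 : Multiple 2 (P 𝐩 N - 1ℚ)
  P-at-p≈1 = multiple-resp (ring 𝐩 (P 𝐩 N) (H² N))
    (multiple-suc (multiple-suc (P-at-p ℕₚ.≤-refl)) ⊖ multiple-p ⊗ multiple-p ⊗ multiple-H² ℕₚ.≤-refl)
    where
    ring : ∀ p q h → q - (1ℚ - p * p * h) - p * p * h ≡ q - 1ℚ
    ring = solve-∀ ℚ-ring

  multiple-cancel-p+ : ∀ {s x a} → suc a ℕ.≤ N → Multiple s (x * (𝐩 + ℚ[ suc a ])) → Multiple s x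
  multiple-cancel-p+ {s} {x} {a} a<N mx = multiple-cancel (p∤-+ a<N)
    (subst (λ c → Multiple s (x * c)) (sym (ℚ[]-+ (suc N) (suc a))) mx)

  -- The step from p to p + 1 contributes the factor 2p². Each later step multiplies `P` by a²/(a +
  -- 1)² modulo p, so a² `P` at p + a is preserved modulo p³; the first component supplies the
  -- divisibility by p² that turns this into a congruence modulo p³.
  P-near-p : ∀ a → suc a ℕ.≤ N →
    Multiple 2 (P (𝐩 + ℚ[ suc a ]) N) ×
    Multiple 3 (ℚ[ suc a ] * ℚ[ suc a ] * P (𝐩 + ℚ[ suc a ]) N - ℚ[ 2 ] * 𝐩 * 𝐩)
  P-near-p zero a<N =
      multiple-cancel (p∤-≤ a<N) (multiple-cancel-p+ a<N (multiple-resp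
        (sym (≡-modulo (ring₁ q′ q 𝐩) (vanish step)))
        (multiple-p ⊗ multiple-p ⊗ (P-at-p≈1′ ⊕ multiple-ℕ 1) ⊗ multiple-ℕ 2)))
    , multiple-cancel (p∤-≤ a<N) (multiple-cancel-p+ a<N (multiple-resp
        (sym (≡-modulo (ring₂ q′ q 𝐩) (vanish step)))
        (multiple-p ⊗ multiple-p ⊗ multiple-ℕ 2 ⊗ (multiple-suc P-at-p≈1 ⊖ multiple-p))))
    where
    q  = P 𝐩 N
    q′ = P (𝐩 + ℚ[ 1 ]) N
    P-at-p≈1′ : Multiple 0 (P 𝐩 N - 1ℚ)
    P-at-p≈1′ = multiple-suc (multiple-suc P-at-p≈1)
    step : q′ * ℚ[ 1 ] * (𝐩 + ℚ[ 1 ]) ≡ q * 𝐩 * (ℚ[ 2 ] * 𝐩 + ℚ[ 0 ])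
    step = subst (λ y → q′ * ℚ[ 1 ] * (𝐩 + ℚ[ 1 ]) ≡ P y N * y * (ℚ[ 2 ] * 𝐩 + ℚ[ 0 ]))
                 (ℚₚ.+-identityʳ 𝐩) (P-near-p-step 0)
    ring₁ : ∀ q′ q p → q′ * ℚ[ 1 ] * (p + ℚ[ 1 ]) ≡
      p * p * (q - 1ℚ + ℚ[ 1 ]) * ℚ[ 2 ]
      + (q′ * ℚ[ 1 ] * (p + ℚ[ 1 ]) - q * p * (ℚ[ 2 ] * p + ℚ[ 0 ])) * 1ℚ
    ring₁ = solve-∀ ℚ-ring
    ring₂ : ∀ q′ q p → (ℚ[ 1 ] * ℚ[ 1 ] * q′ - ℚ[ 2 ] * p * p) * ℚ[ 1 ] * (p + ℚ[ 1 ]) ≡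
      p * p * ℚ[ 2 ] * (q - 1ℚ - p)
      + (q′ * ℚ[ 1 ] * (p + ℚ[ 1 ]) - q * p * (ℚ[ 2 ] * p + ℚ[ 0 ])) * 1ℚ
    ring₂ = solve-∀ ℚ-ring
  P-near-p (suc a) a<N = q′∈p² , multiple-resp
      (sym (≡-modulo (ring q′ q 𝐩 α′ α) (vanish step)))
      (proj₂ ih ⊕ multiple-p ⊗ proj₁ ih ⊗ (multiple-ℕ 3 ⊗ multiple-ℕ (suc a) ⊕ multiple-ℕ 2 ⊗ multiple-ℕ (suc N))
       ⊖ multiple-p ⊗ q′∈p² ⊗ multiple-ℕ (suc (suc a)))
    where
    ih = P-near-p a (ℕₚ.<⇒≤ a<N)
    α  = ℚ[ suc a ]
    α′ = ℚ[ suc (suc a) ]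
    q  = P (𝐩 + α) N
    q′ = P (𝐩 + α′) N
    step : q′ * α′ * (𝐩 + α′) ≡ q * (𝐩 + α) * (ℚ[ 2 ] * 𝐩 + α)
    step = P-near-p-step (suc a)
    q′∈p² : Multiple 2 q′
    q′∈p² = multiple-cancel (p∤-≤ a<N) (multiple-cancel-p+ a<N (multiple-resp (sym step)
      (proj₁ ih ⊗ (multiple-ℕ (suc N) ⊕ multiple-ℕ (suc a)) ⊗ (multiple-ℕ 2 ⊗ multiple-ℕ (suc N) ⊕ multiple-ℕ (suc a)))))
    ring : ∀ q′ q p α′ α → α′ * α′ * q′ - ℚ[ 2 ] * p * p ≡
      α * α * q - ℚ[ 2 ] * p * p + p * q * (ℚ[ 3 ] * α + ℚ[ 2 ] * p) - p * q′ * α′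
      + (q′ * α′ * (p + α′) - q * (p + α) * (ℚ[ 2 ] * p + α)) * 1ℚ
    ring = solve-∀ ℚ-ring

  -- The congruence between x = p + s and x = p - 1 - s.

  -- The induction step of `F-reflection` cleared of denominators: `q` and `o` are `P` at c and at b
  -- (the latter 0), `ra` and `rb` are 1/a and 1/b. Modulo p³, -2/c - 2/b - 2p/a² - 2p/b² leaves
  -- -4p²/a³, which 2`q`/c cancels since `q` ≡ 2p²/a².
  increment-identity : ∀ {p a b} → p ≡ a + b → ∀ fc fc′ fb fb′ q o ra rb → let c = p + a in
    (fc - fc′ + (fb - fb′) - ℚ[ 2 ] * p * (ra * ra) - ℚ[ 2 ] * p * (rb * rb)) * a * a * b * b * c ≡
    ℚ[ 2 ] * b * b * (a * a * q - ℚ[ 2 ] * p * p) + p * p * p * (ℚ[ 2 ] * p - ℚ[ 6 ] * a)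
    + ((c * (fc - fc′) - ℚ[ 2 ] * (q - 1ℚ)) * (a * a * b * b)
       + (b * (fb - fb′) - ℚ[ 2 ] * (o - 1ℚ)) * (a * a * b * c)
       + (o - 0ℚ) * (ℚ[ 2 ] * a * a * b * c)
       + (a * ra - 1ℚ) * (- (ℚ[ 2 ] * p * b * b * c * (a * ra + 1ℚ)))
       + (b * rb - 1ℚ) * (- (ℚ[ 2 ] * p * a * a * c * (b * rb + 1ℚ))))
  increment-identity {a = a} {b} refl = ring a b
    where
    ring : ∀ a b fc fc′ fb fb′ q o ra rb →
      (fc - fc′ + (fb - fb′) - ℚ[ 2 ] * (a + b) * (ra * ra) - ℚ[ 2 ] * (a + b) * (rb * rb)) * a * a * b * b * (a + b + a) ≡
      ℚ[ 2 ] * b * b * (a * a * q - ℚ[ 2 ] * (a + b) * (a + b)) + (a + b) * (a + b) * (a + b) * (ℚ[ 2 ] * (a + b) - ℚ[ 6 ] * a)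
      + (((a + b + a) * (fc - fc′) - ℚ[ 2 ] * (q - 1ℚ)) * (a * a * b * b)
         + (b * (fb - fb′) - ℚ[ 2 ] * (o - 1ℚ)) * (a * a * b * (a + b + a))
         + (o - 0ℚ) * (ℚ[ 2 ] * a * a * b * (a + b + a))
         + (a * ra - 1ℚ) * (- (ℚ[ 2 ] * (a + b) * b * b * (a + b + a) * (a * ra + 1ℚ)))
         + (b * rb - 1ℚ) * (- (ℚ[ 2 ] * (a + b) * a * a * (a + b + a) * (b * rb + 1ℚ))))
    ring = solve-∀ ℚ-ring

  -- As q (q + 1) = (s - p)(s - p + 1), this compares `F` at s + p and s - p. The correction in `H²`
  -- carries the induction and disappears at q = s.
  F-reflection : ∀ s q → q ℕ.+ s ≡ N →
    Multiple 3 (F (𝐩 + ℚ[ s ]) - F ℚ[ q ] + ℚ[ 2 ] * 𝐩 * (H² q - H² s))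
  F-reflection zero q q≡N with refl ← trans (sym (ℕₚ.+-identityʳ q)) q≡N =
    subst (λ y → Multiple 3 (F y - F ℚ[ N ] + ℚ[ 2 ] * 𝐩 * (H² N - 0ℚ))) (sym (ℚₚ.+-identityʳ 𝐩))
      -- Dividing by p costs one power, hence the precision p⁴ in `P-at-p`.
      (multiple-cancel-p (multiple-resp
        (sym (≡-modulo (ring 𝐩 (F 𝐩) (F ℚ[ N ]) (H² N) (P 𝐩 N)) (vanish (F-difference ℚ[ N ] (ℚ[]-suc N)))))
        (multiple-ℕ 2 ⊗ P-at-p ℕₚ.≤-refl)))
    where
    ring : ∀ p f f′ h q → p * (f - f′ + ℚ[ 2 ] * p * (h - 0ℚ)) ≡
      ℚ[ 2 ] * (q - (1ℚ - p * p * h)) + (p * (f - f′) - ℚ[ 2 ] * (q - 1ℚ)) * 1ℚ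
    ring = solve-∀ ℚ-ring
  F-reflection (suc s) q q+1+s≡N = multiple-resp
      (ring (F (𝐩 + a)) (F (𝐩 + ℚ[ s ])) (F b) (F ℚ[ q ]) 𝐩 ra rb (H² q) (H² s))
      (F-reflection s (suc q) 1+q+s≡N ⊕
       multiple-cancel (p∤-≤ s<N) (multiple-cancel (p∤-≤ s<N)
        (multiple-cancel (p∤-≤ q<N) (multiple-cancel (p∤-≤ q<N) (multiple-cancel-p+ s<N (multiple-resp
          (sym (≡-modulo
            (increment-identity p≡a+b (F (𝐩 + a)) (F (𝐩 + ℚ[ s ])) (F b) (F ℚ[ q ]) (P (𝐩 + a) N) (P b N) ra rb)
            (vanish (F-difference (𝐩 + ℚ[ s ]) (trans (cong (λ z → 𝐩 + z) (ℚ[]-suc s)) (sym (ℚₚ.+-assoc 𝐩 ℚ[ s ] 1ℚ))))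
             ⊞ vanish (F-difference ℚ[ q ] (ℚ[]-suc q))
             ⊞ vanish (P-root q<N) ⊞ vanish (*-recip s) ⊞ vanish (*-recip q))))
          (multiple-ℕ 2 ⊗ multiple-ℕ (suc q) ⊗ multiple-ℕ (suc q) ⊗ proj₂ (P-near-p s s<N)
           ⊕ multiple-p ⊗ multiple-p ⊗ multiple-p
             ⊗ (multiple-ℕ 2 ⊗ multiple-ℕ (suc N) ⊖ multiple-ℕ 6 ⊗ multiple-ℕ (suc s)))))))))
    where
    a  = ℚ[ suc s ]
    b  = ℚ[ suc q ]
    ra = recip (suc s)
    rb = recip (suc q)
    1+q+s≡N : suc q ℕ.+ s ≡ N
    1+q+s≡N = trans (sym (ℕₚ.+-suc q s)) q+1+s≡N
    s<N : suc s ℕ.≤ N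
    s<N = subst (suc s ℕ.≤_) q+1+s≡N (ℕₚ.m≤n+m (suc s) q)
    q<N : suc q ℕ.≤ N
    q<N = subst (suc q ℕ.≤_) 1+q+s≡N (ℕₚ.m≤m+n (suc q) s)
    p≡a+b : 𝐩 ≡ a + b
    p≡a+b = trans (cong (λ n → ℚ[ suc n ]) (trans (sym 1+q+s≡N) (ℕₚ.+-comm (suc q) s))) (ℚ[]-+ (suc s) (suc q))
    ring : ∀ fc fc′ fb fb′ p ra rb hq hs →
      fc′ - fb + ℚ[ 2 ] * p * (hq + rb * rb - hs)
      + (fc - fc′ + (fb - fb′) - ℚ[ 2 ] * p * (ra * ra) - ℚ[ 2 ] * p * (rb * rb)) ≡
      fc - fb′ + ℚ[ 2 ] * p * (hq - (hs + ra * ra))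
    ring = solve-∀ ℚ-ring

  -- Expansion in u = p²/4 around w = -1/4.

  u : ℚ
  u = 𝐩 * half * (𝐩 * half)

  -¼ : ℚ
  -¼ = - (half * half)

  module _ (2≤N : 2 ℕ.≤ N) where

    multiple-half : Multiple 0 half
    multiple-half = integral⇒multiple (integral 2 (p∤-≤ 2≤N) 1ℤ refl)

    multiple-u : Multiple 2 u
    multiple-u = multiple-p ⊗ multiple-half ⊗ (multiple-p ⊗ multiple-half)

    -- In 9 f(u) - f(9u) - 8 f(0) the constant and linear terms in u cancel, leaving u² and hence
    -- p⁴. Each component feeds the induction step of the next.
    T-expansion : ∀ k → k ℕ.≤ N →
      Multiple 0 (T -¼ k) ×
      Multiple 2 (T (-¼ + u) k - T -¼ k) ×
      Multiple 4 (ℚ[ 9 ] * T (-¼ + u) k - T (-¼ + ℚ[ 9 ] * u) k - ℚ[ 8 ] * T -¼ k)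
    T-expansion zero    _   = multiple-ℕ 1 ,
      multiple-resp (ring₁ 𝐩) (multiple-p ⊗ multiple-p ⊗ multiple-ℕ 0) ,
      multiple-resp (ring₂ 𝐩) (multiple-p ⊗ multiple-p ⊗ (multiple-p ⊗ multiple-p) ⊗ multiple-ℕ 0)
      where
      ring₁ : ∀ p → p * p * ℚ[ 0 ] ≡ 1ℚ - 1ℚ
      ring₁ = solve-∀ ℚ-ring
      ring₂ : ∀ p → p * p * (p * p) * ℚ[ 0 ] ≡ ℚ[ 9 ] * 1ℚ - 1ℚ - ℚ[ 8 ] * 1ℚ
      ring₂ = solve-∀ ℚ-ring
    T-expansion (suc k) k<N with T-expansion k (ℕₚ.<⇒≤ k<N)
    ... | t₀ , Δ , Δ² =
        t₀ ⊗ a ⊗ r²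
      , multiple-resp (ring₁ (T -¼ k) (T (-¼ + u) k) κ -¼ u ρ)
          (Δ ⊗ (a ⊗ r²) ⊖ multiple-u ⊗ ((multiple-suc (multiple-suc Δ) ⊕ t₀) ⊗ r²))
      , multiple-resp (ring₂ (T -¼ k) (T (-¼ + u) k) (T (-¼ + ℚ[ 9 ] * u) k) κ -¼ u ρ)
          -- The new factor contributes 9u (t₉ - t₁), where t₉ - t₁ = 8 (t₁ - t₀) - (9t₁ - t₉ - 8t₀)
          -- is itself divisible by p².
          (Δ² ⊗ (a ⊗ r²) ⊕ multiple-u ⊗ (multiple-ℕ 8 ⊗ Δ ⊖ multiple-suc (multiple-suc Δ²)) ⊗ (multiple-ℕ 9 ⊗ r²))
      where
      κ = ℚ[ k ] * (ℚ[ k ] + 1ℚ)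
      ρ = recip (suc k) * recip (suc k)
      r² : Multiple 0 ρ
      r² = multiple-recip² k<N
      a : Multiple 0 (κ - -¼)
      a = multiple-ℕ k ⊗ (multiple-ℕ k ⊕ multiple-ℕ 1) ⊖ multiple-neg (multiple-half ⊗ multiple-half)
      ring₁ : ∀ t₀ t₁ κ w u ρ →
        (t₁ - t₀) * ((κ - w) * ρ) - u * ((t₁ - t₀ + t₀) * ρ) ≡ t₁ * (κ - (w + u)) * ρ - t₀ * (κ - w) * ρ
      ring₁ = solve-∀ ℚ-ring
      ring₂ : ∀ t₀ t₁ t₉ κ w u ρ →
        (ℚ[ 9 ] * t₁ - t₉ - ℚ[ 8 ] * t₀) * ((κ - w) * ρ)
        + u * (ℚ[ 8 ] * (t₁ - t₀) - (ℚ[ 9 ] * t₁ - t₉ - ℚ[ 8 ] * t₀)) * (ℚ[ 9 ] * ρ) ≡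
        ℚ[ 9 ] * (t₁ * (κ - (w + u)) * ρ) - t₉ * (κ - (w + ℚ[ 9 ] * u)) * ρ - ℚ[ 8 ] * (t₀ * (κ - w) * ρ)
      ring₂ = solve-∀ ℚ-ring

    S₁-expansion : ∀ n → n ℕ.≤ N →
      Multiple 4 (ℚ[ 9 ] * S₁ (-¼ + u) n - S₁ (-¼ + ℚ[ 9 ] * u) n - ℚ[ 8 ] * S₁ -¼ n)
    S₁-expansion zero    _   = multiple-resp (ring 𝐩) (multiple-p ⊗ multiple-p ⊗ (multiple-p ⊗ multiple-p) ⊗ multiple-ℕ 0)
      where
      ring : ∀ p → p * p * (p * p) * ℚ[ 0 ] ≡ ℚ[ 9 ] * 0ℚ - 0ℚ - ℚ[ 8 ] * 0ℚ
      ring = solve-∀ ℚ-ring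
    S₁-expansion (suc n) n<N = multiple-resp
        (ring (S₁ -¼ n) (S₁ (-¼ + u) n) (S₁ (-¼ + ℚ[ 9 ] * u) n)
              (T -¼ (suc n)) (T (-¼ + u) (suc n)) (T (-¼ + ℚ[ 9 ] * u) (suc n)) (recip (suc n)))
        (S₁-expansion n (ℕₚ.<⇒≤ n<N) ⊕ proj₂ (proj₂ (T-expansion (suc n) n<N)) ⊗ multiple-recip (p∤-≤ n<N))
      where
      ring : ∀ s₀ s₁ s₉ t₀ t₁ t₉ r →
        ℚ[ 9 ] * s₁ - s₉ - ℚ[ 8 ] * s₀ + (ℚ[ 9 ] * t₁ - t₉ - ℚ[ 8 ] * t₀) * r ≡
        ℚ[ 9 ] * (s₁ + t₁ * r) - (s₉ + t₉ * r) - ℚ[ 8 ] * (s₀ + t₀ * r)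
      ring = solve-∀ ℚ-ring

    S₂-expansion : ∀ n → n ℕ.≤ N → Multiple 2 (S₂ -¼ n - S₂ (-¼ + u) n)
    S₂-expansion zero    _   = multiple-resp (ring 𝐩) (multiple-p ⊗ multiple-p ⊗ multiple-ℕ 0)
      where
      ring : ∀ p → p * p * ℚ[ 0 ] ≡ 0ℚ - 0ℚ
      ring = solve-∀ ℚ-ring
    S₂-expansion (suc n) n<N = multiple-resp
        (ring (S₂ -¼ n) (S₂ (-¼ + u) n) (T -¼ (suc n)) (T (-¼ + u) (suc n)) (recip (suc n) * recip (suc n)))
        (S₂-expansion n (ℕₚ.<⇒≤ n<N) ⊖ proj₁ (proj₂ (T-expansion (suc n) n<N)) ⊗ multiple-recip² n<N)
      where
      ring : ∀ s₀ s₁ t₀ t₁ ρ → s₀ - s₁ - (t₁ - t₀) * ρ ≡ s₀ + t₀ * ρ - (s₁ + t₁ * ρ)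
      ring = solve-∀ ℚ-ring

    -- Evaluation at x = m and x = p + m.

    module _ {m : ℕ} (m+m≡N : m ℕ.+ m ≡ N) where

      m≤N : m ℕ.≤ N
      m≤N = subst (m ℕ.≤_) m+m≡N (ℕₚ.m≤m+n m m)

      p≡2m+1 : 𝐩 ≡ ℚ[ m ] + ℚ[ m ] + 1ℚ
      p≡2m+1 = trans (ℚ[]-suc N) (cong (_+ 1ℚ) (trans (cong ℚ[_] (sym m+m≡N)) (ℚ[]-+ m m)))

      m[m+1]≡-¼+u : ℚ[ m ] * (ℚ[ m ] + 1ℚ) ≡ -¼ + u
      m[m+1]≡-¼+u = identity {𝐩} {ℚ[ m ]} p≡2m+1
        where
        ring : ∀ m → m * (m + 1ℚ) ≡ - (half * half) + (m + m + 1ℚ) * half * ((m + m + 1ℚ) * half)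
        ring = solve-∀ ℚ-ring
        identity : ∀ {p m} → p ≡ m + m + 1ℚ → m * (m + 1ℚ) ≡ - (half * half) + p * half * (p * half)
        identity {m = m} refl = ring m

      -- The source of the constant 9: x (x + 1) = (x + 1/2)² - 1/4, and x + 1/2 is p/2 at x = m but
      -- 3p/2 at x = p + m.
      [p+m][p+m+1]≡-¼+9u : (𝐩 + ℚ[ m ]) * (𝐩 + ℚ[ m ] + 1ℚ) ≡ -¼ + ℚ[ 9 ] * u
      [p+m][p+m+1]≡-¼+9u = identity {𝐩} {ℚ[ m ]} p≡2m+1
        where
        ring : ∀ m → (m + m + 1ℚ + m) * (m + m + 1ℚ + m + 1ℚ) ≡
          - (half * half) + ℚ[ 9 ] * ((m + m + 1ℚ) * half * ((m + m + 1ℚ) * half))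
        ring = solve-∀ ℚ-ring
        identity : ∀ {p m} → p ≡ m + m + 1ℚ →
          (p + m) * (p + m + 1ℚ) ≡ - (half * half) + ℚ[ 9 ] * (p * half * (p * half))
        identity {m = m} refl = ring m

      S₁[-¼]≈-2H : Multiple 3 (S₁ -¼ N - - (ℚ[ 2 ] * H m))
      S₁[-¼]≈-2H = subst (λ x → Multiple 3 (S₁ -¼ N - x)) (S₁-at-ℕ m N m≤N) (multiple-resp
          (≡-modulo (ring (S₁ -¼ N) (S₁ (-¼ + u) N) (S₁ (-¼ + ℚ[ 9 ] * u) N) (F ℚ[ m ]) (F (𝐩 + ℚ[ m ])) 𝐩 (H² m))
            (vanish (cong (λ w → S₁ w N) m[m+1]≡-¼+u) ⊞ vanish (cong (λ w → S₁ w N) [p+m][p+m+1]≡-¼+9u)))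
          -- Adding F(p + m) - F(m) to the expansion leaves 8 F(m) - 8 S₁(-1/4), and -1/8 is
          -- p-integral.
          (multiple-neg (multiple-half ⊗ multiple-half ⊗ multiple-half)
           ⊗ (multiple-suc (S₁-expansion N ℕₚ.≤-refl) ⊕ F-reflection m m m+m≡N)))
        where
        ring : ∀ s₀ s₁ s₉ f₁ f₉ p h →
          - (half * half * half) * (ℚ[ 9 ] * s₁ - s₉ - ℚ[ 8 ] * s₀ + (f₉ - f₁ + ℚ[ 2 ] * p * (h - h))) ≡
          s₀ - f₁ + ((f₁ - s₁) * (ℚ[ 9 ] * (half * half * half)) + (f₉ - s₉) * (- (half * half * half)))
        ring = solve-∀ ℚ-ring

      S₂[-¼]≈-2H² : Multiple 2 (S₂ -¼ N - - (ℚ[ 2 ] * (H m * H m)))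
      S₂[-¼]≈-2H² = subst (λ x → Multiple 2 (S₂ -¼ N - x))
        (trans (cong (λ w → S₂ w N) (sym m[m+1]≡-¼+u)) (S₂-at-ℕ m N m≤N)) (S₂-expansion N ℕₚ.≤-refl)

-- Parity of p - 1 and the two congruences.

[p∸1]/2-doubled : ∀ {p} → Prime p → p > 3 → (p ∸ 1) / 2 ℕ.+ (p ∸ 1) / 2 ≡ p ∸ 1
[p∸1]/2-doubled {suc N} pr p>3 with N % 2 | m≡m%n+[m/n]*n N 2 | m%n<n N 2
... | 0 | N≡ | _ = sym (trans N≡ (trans (ℕₚ.*-comm (N / 2) 2) (cong (N / 2 ℕ.+_) (ℕₚ.+-identityʳ (N / 2)))))
-- For odd N the prime N + 1 is even, hence equal to 2.
... | 1 | N≡ | _ with prime⇒irreducible pr (divides (suc (N / 2)) (cong suc N≡))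
...   | inj₂ refl = contradiction p>3 λ { (s≤s (s≤s ())) }
[p∸1]/2-doubled pr p>3 | suc (suc _) | _ | s≤s (s≤s ())

theorem4p2 : (p : ℕ) → Prime p → p > 3 →
    (sumFrom1 (p ∸ 1) (λ k → ((poch half k * poch half k) ÷ (poch ℚ[ 1 ] k * poch ℚ[ 1 ] k)) * (ℚ[ 1 ] ÷ ℚ[ k ]))
    ≡ - (ℚ[ 2 ] * H ((p ∸ 1) / 2)) [mod p ^ 3 ])
    ×
    (sumFrom1 (p ∸ 1) (λ k → ((poch half k * poch half k) ÷ (poch ℚ[ 1 ] k * poch ℚ[ 1 ] k)) * (ℚ[ 1 ] ÷ (ℚ[ k ] * ℚ[ k ])))
    ≡ - (ℚ[ 2 ] * (H ((p ∸ 1) / 2) * H ((p ∸ 1) / 2))) [mod p ^ 2 ])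
theorem4p2 p@(suc N) pr p>3 =
    subst (_≡ - (ℚ[ 2 ] * H m) [mod p ^ 3 ])
      (sumFrom1-cong (λ k → cong (_* recip (suc k)) (sym (poch-quotient (suc k)))) N)
      (multiple⇒mod (S₁ -¼ N) (- (ℚ[ 2 ] * H m)) (S₁[-¼]≈-2H 2≤N {m} m+m≡N))
  , subst (_≡ - (ℚ[ 2 ] * (H m * H m)) [mod p ^ 2 ])
      (sumFrom1-cong (λ k → cong₂ _*_ (sym (poch-quotient (suc k))) (sym (recip-square k))) N)
      (multiple⇒mod (S₂ -¼ N) (- (ℚ[ 2 ] * (H m * H m))) (S₂[-¼]≈-2H² 2≤N {m} m+m≡N))
  where
  open PAdic pr
  open Congruences pr
  m = N / 2
  m+m≡N : m ℕ.+ m ≡ N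
  m+m≡N = [p∸1]/2-doubled pr p>3
  2≤N : 2 ℕ.≤ N
  2≤N = ℕₚ.<⇒≤ (ℕₚ.≤-pred p>3)
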